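{- The reduction relation $\to_{\mathtt w}$ of the $\lambda!$-calculus satisfies: (1) $\to_{\mathtt w}$ is confluent. (2) Any two different $\to_{\mathtt w}$-reduction paths from a given term to $\mathtt w$-normal form have the same length (number of steps).
   Context: Terms of the $\lambda!$-calculus, over a countably infinite set of variables $x,y,z,\dots$: $t,u ::= x \mid t\,u \mid \lambda x.t \mid {!t} \mid \mathrm{der}\,t \mid t[x\backslash u]$. The construct $[x\backslash u]$ is an explicit substitution (part of the syntax); $\lambda x.t$ and $t[x\backslash u]$ bind $x$ in $t$ (not in $u$). Terms are considered modulo $\alpha$-conversion. $t\{x\backslash u\}$ denotes capture-avoiding meta-level substitution. List contexts: $L ::= \Box \mid L[x\backslash t]$. Weak contexts: $W ::= \Box \mid W\,t \mid t\,W \mid \lambda x.W \mid \mathrm{der}\,W \mid W[x\backslash u] \mid t[x\backslash W]$ (the hole never occurs under $!$). $C\langle t\rangle$ is the term obtained by replacing the hole of a context $C$ by $t$ (variables may be captured). Rewriting rules (all assumed to avoid capture of free variables): $\mathtt{dB}$: $L\langle\lambda x.t\rangle\,u \mapsto L\langle t[x\backslash u]\rangle$; $\mathtt{s!}$: $t[x\backslash L\langle !u\rangle] \mapsto L\langle t\{x\backslash u\}\rangle$; $\mathtt{d!}$: $\mathrm{der}(L\langle !t\rangle)\mapsto L\langle t\rangle$. $\to_{\mathtt{dB}},\to_{\mathtt{s!}},\to_{\mathtt{d!}}$ are the closures of these rules under weak contexts, and $\to_{\mathtt w}$ is their union. A term $t$ is $\mathtt w$-normal if there is no $t'$ with $t\to_{\mathtt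 w}t'$. -}

module Defs where

open import Level using (Level; 0ℓ)
open import Data.Nat.Base using (ℕ; zero; suc)
open import Data.Fin.Base using (Fin)
open import Data.Fin.Substitution
  using (Sub; Lift; TermSubst; module VarSubst)
open import Data.Vec.Base using (lookup)
open import Relation.Binary.Core using (Rel)
open import Relation.Binary.Construct.Union using (_∪_)
open import Relation.Binary.Construct.Closure.ReflexiveTransitive
  using (Star; ε; _◅_)

infixl 9 _·_
infix  10 !_
infix  9 _[_]

-- Terms modulo α-conversion, as well-scoped de Bruijn terms: Term n is the
-- set of α-classes of terms whose free variables are among n given ones.

data Term (n : ℕ) : Set where
  var  : (x : Fin n) → Term n
  _·_  : (t u : Term n) → Term n
  ƛ    : (t : Term (suc n)) → Term n
  !_   : (t : Term n) → Term n
  der  : (t : Term n) → Term n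
  -- Explicit substitution t[x\u]: x is variable 0 of t, and is not in
  -- scope in u.
  _[_] : (t : Term (suc n)) (u : Term n) → Term n

module TermApp {ℓ : Level} {T : ℕ → Set ℓ} (l : Lift T Term) where
  open Lift l hiding (var)

  infixl 8 _/_

  _/_ : ∀ {m n} → Term m → Sub T m n → Term n
  var x   / ρ = lift (lookup ρ x)
  (t · u) / ρ = (t / ρ) · (u / ρ)
  ƛ t     / ρ = ƛ (t / ρ ↑)
  (! t)   / ρ = ! (t / ρ)
  der t   / ρ = der (t / ρ)
  t [ u ] / ρ = (t / ρ ↑) [ u / ρ ]

termSubst : TermSubst Term
termSubst = record { var = var; app = TermApp._/_ }

open TermSubst termSubst public using (_/_; _/Var_; sub)

-- In a context indexed by n and m, n counts the variables in scope outside
-- the context and m those in scope at the hole. Filling the hole may thus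
-- capture variables.

data LCtx : ℕ → ℕ → Set where
  □    : ∀ {n} → LCtx n n
  _[_] : ∀ {n m} (L : LCtx (suc n) m) (u : Term n) → LCtx n m

infix 10 _⟨_⟩ᴸ _⟨_⟩ᵂ

_⟨_⟩ᴸ : ∀ {n m} → LCtx n m → Term m → Term n
□         ⟨ t ⟩ᴸ = t
(L [ u ]) ⟨ t ⟩ᴸ = (L ⟨ t ⟩ᴸ) [ u ]

-- The renaming that moves a term from outside L to the hole of L without
-- any of its variables being captured.

wkᴸ : ∀ {n m} → LCtx n m → Sub Fin n m
wkᴸ □         = VarSubst.id
wkᴸ (L [ u ]) = VarSubst.wk VarSubst.⊙ wkᴸ L

data WCtx : ℕ → ℕ → Set where
  □     : ∀ {n} → WCtx n n
  _·ˡ_  : ∀ {n m} (W : WCtx n m) (t : Term n) → WCtx n m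
  _·ʳ_  : ∀ {n m} (t : Term n) (W : WCtx n m) → WCtx n m
  ƛ     : ∀ {n m} (W : WCtx (suc n) m) → WCtx n m
  der   : ∀ {n m} (W : WCtx n m) → WCtx n m
  _[_]ˡ : ∀ {n m} (W : WCtx (suc n) m) (u : Term n) → WCtx n m
  _[_]ʳ : ∀ {n m} (t : Term (suc n)) (W : WCtx n m) → WCtx n m

_⟨_⟩ᵂ : ∀ {n m} → WCtx n m → Term m → Term n
□          ⟨ s ⟩ᵂ = s
(W ·ˡ t)   ⟨ s ⟩ᵂ = W ⟨ s ⟩ᵂ · t
(t ·ʳ W)   ⟨ s ⟩ᵂ = t · W ⟨ s ⟩ᵂ
ƛ W        ⟨ s ⟩ᵂ = ƛ (W ⟨ s ⟩ᵂ)
der W      ⟨ s ⟩ᵂ = der (W ⟨ s ⟩ᵂ)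
(W [ u ]ˡ) ⟨ s ⟩ᵂ = (W ⟨ s ⟩ᵂ) [ u ]
(t [ W ]ʳ) ⟨ s ⟩ᵂ = t [ W ⟨ s ⟩ᵂ ]

infix 4 _↦dB_ _↦s!_ _↦d!_ _→dB_ _→s!_ _→d!_ _→w_

-- The weakenings along L implement the proviso that the list context L
-- does not capture free variables of the subterms moved into its scope.

data _↦dB_ {n : ℕ} : Rel (Term n) 0ℓ where
  dB : ∀ {m} (L : LCtx n m) (t : Term (suc m)) (u : Term n) →
       L ⟨ ƛ t ⟩ᴸ · u ↦dB L ⟨ t [ u /Var wkᴸ L ] ⟩ᴸ

data _↦s!_ {n : ℕ} : Rel (Term n) 0ℓ where
  s! : ∀ {m} (t : Term (suc n)) (L : LCtx n m) (u : Term m) →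
       t [ L ⟨ ! u ⟩ᴸ ] ↦s! L ⟨ (t /Var (wkᴸ L VarSubst.↑)) / sub u ⟩ᴸ

data _↦d!_ {n : ℕ} : Rel (Term n) 0ℓ where
  d! : ∀ {m} (L : LCtx n m) (t : Term m) →
       der (L ⟨ ! t ⟩ᴸ) ↦d! L ⟨ t ⟩ᴸ

data WeakClosure (_↦_ : ∀ {m} → Rel (Term m) 0ℓ) {n : ℕ} :
                 Rel (Term n) 0ℓ where
  weak : ∀ {m} (W : WCtx n m) {s s′ : Term m} → s ↦ s′ →
         WeakClosure _↦_ (W ⟨ s ⟩ᵂ) (W ⟨ s′ ⟩ᵂ)

_→dB_ _→s!_ _→d!_ _→w_ : ∀ {n} → Rel (Term n) 0ℓ
_→dB_ = WeakClosure _↦dB_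
_→s!_ = WeakClosure _↦s!_
_→d!_ = WeakClosure _↦d!_
_→w_  = _→dB_ ∪ _→s!_ ∪ _→d!_

length : ∀ {i r} {I : Set i} {R : Rel I r} {x y} → Star R x y → ℕ
length ε       = zero
length (_ ◅ p) = suc (length p)

{-# OPTIONS --safe #-}

-- Two distinct one-step reducts of a term have a common one-step reduct: weak
-- contexts never enter a bang, so a substitution s! never copies or erases a
-- redex.  This diamond property yields confluence, and also that a step from
-- t lowers the length of a given path from t to normal form by exactly one.

module Submission where

open import Defs
open import Level using (0ℓ)
open import Data.Fin.Base using (Fin)
open import Data.Fin.Substitution using (Sub; Subs; Lift; module TermSubst; module VarSubst)
open import Data.Fin.Substitution.Lemmas using (TermLemmas; module VarLemmas)
open import Data.Nat.Base using (ℕ; suc)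
open import Data.Product.Base using (_×_; _,_; ∃)
open import Data.Sum.Base as Sum using (_⊎_; inj₁; inj₂)
open import Data.Vec.Base using (_∷_; map; lookup)
open import Relation.Binary.Core using (Rel)
open import Relation.Binary.PropositionalEquality
  using (_≡_; refl; sym; trans; cong; cong₂; subst; module ≡-Reasoning)
open import Relation.Binary.Construct.Closure.ReflexiveTransitive
  using (Star; ε; _◅_; _◅◅_)
open import Relation.Binary.Rewriting using (Confluent; IsNormalForm)
open import Relation.Nullary.Negation using (contradiction)

private
  variable
    m n : ℕ

-- Abstract rewriting

-- Either the two reducts coincide, or exactly one step on each side closes the peak. This even
-- count is what makes path lengths comparable.
Joinable : ∀ {a ℓ} {A : Set a} → Rel A ℓ → Rel A _
Joinable R x y = x ≡ y ⊎ ∃ λ z → R x z × R y z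

Diamond : ∀ {a ℓ} {A : Set a} → Rel A ℓ → Set _
Diamond R = ∀ {x y z} → R x y → R x z → Joinable R y z

joinable-map : ∀ {a b ℓ r} {A : Set a} {B : Set b} (R : Rel A ℓ) (S : Rel B r)
               (f : A → B) → (∀ {x y} → R x y → S (f x) (f y)) →
               ∀ {x y} → Joinable R x y → Joinable S (f x) (f y)
joinable-map R S f g (inj₁ x≡y)             = inj₁ (cong f x≡y)
joinable-map R S f g (inj₂ (z , x→z , y→z)) = inj₂ (f z , g x→z , g y→z)

module _ {a ℓ} {A : Set a} {R : Rel A ℓ} (diamond : Diamond R) where

  -- The single step is pushed along the path tile by tile. A tile never turns it into several
  -- steps, so structural recursion on the path suffices.
  strip : ∀ {x y z} → R x y → Star R x z →
          ∃ λ w → Star R y w × Star R z w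
  strip x→y ε = _ , ε , x→y ◅ ε
  strip x→y (x→x′ ◅ x′↠z) with diamond x→y x→x′
  ... | inj₁ refl = _ , x′↠z , ε
  ... | inj₂ (_ , y→v , x′→v) =
    let w , v↠w , z↠w = strip x′→v x′↠z in w , y→v ◅ v↠w , z↠w

  diamond⇒confluent : Confluent R
  diamond⇒confluent ε           x↠z = _ , x↠z , ε
  diamond⇒confluent (x→x′ ◅ x′↠y) x↠z =
    let v , x′↠v , z↠v = strip x→x′ x↠z
        w , y↠w , v↠w  = diamond⇒confluent x′↠y x′↠v
    in  w , y↠w , z↠v ◅◅ v↠w

  random-descent : ∀ {x y z} → IsNormalForm R z → (p : Star R x z) → R x y →
                   ∃ λ (q : Star R y z) → length p ≡ suc (length q)
  random-descent nf ε            x→y = contradiction (_ , x→y) nf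
  random-descent nf (x→x′ ◅ x′↠z) x→y with diamond x→y x→x′
  ... | inj₁ refl = x′↠z , refl
  ... | inj₂ (_ , y→v , x′→v) =
    -- The step `y→v` replaces the first step of `p`, so the step lost is the one lost further down
    -- the tail.
    let q , eq = random-descent nf x′↠z x′→v in y→v ◅ q , cong suc eq

  -- Induction on `q`: its first step is traded, by random descent, for one step of `p`, leaving two
  -- normalising paths from a common term.
  normalising-paths-equally-long :
    ∀ {x y z} → IsNormalForm R y → IsNormalForm R z →
    (p : Star R x y) (q : Star R x z) → length p ≡ length q
  normalising-paths-equally-long y-nf z-nf ε ε         = refl
  normalising-paths-equally-long y-nf z-nf (x→ ◅ _) ε  = contradiction (_ , x→) z-nf
  normalising-paths-equally-long y-nf z-nf p (x→ ◅ q)  =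
    let p′ , eq = random-descent y-nf p x→
    in  trans eq (cong suc (normalising-paths-equally-long y-nf z-nf p′ q))

-- Substitution

module _ {T : ℕ → Set} (l : Lift T Term) where

  open TermSubst.Lifted termSubst l using (_↑✶_; _/✶_)

  ·-/✶-↑✶ : ∀ k {t u} (ρs : Subs T m n) →
            t · u /✶ ρs ↑✶ k ≡ (t /✶ ρs ↑✶ k) · (u /✶ ρs ↑✶ k)
  ·-/✶-↑✶ k ε        = refl
  ·-/✶-↑✶ k (ρ ◅ ρs) = cong (λ t → TermApp._/_ l t _) (·-/✶-↑✶ k ρs)

  ƛ-/✶-↑✶ : ∀ k {t} (ρs : Subs T m n) →
            ƛ t /✶ ρs ↑✶ k ≡ ƛ (t /✶ ρs ↑✶ suc k)
  ƛ-/✶-↑✶ k ε        = refl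
  ƛ-/✶-↑✶ k (ρ ◅ ρs) = cong (λ t → TermApp._/_ l t _) (ƛ-/✶-↑✶ k ρs)

  !-/✶-↑✶ : ∀ k {t} (ρs : Subs T m n) → (! t) /✶ ρs ↑✶ k ≡ ! (t /✶ ρs ↑✶ k)
  !-/✶-↑✶ k ε        = refl
  !-/✶-↑✶ k (ρ ◅ ρs) = cong (λ t → TermApp._/_ l t _) (!-/✶-↑✶ k ρs)

  der-/✶-↑✶ : ∀ k {t} (ρs : Subs T m n) → der t /✶ ρs ↑✶ k ≡ der (t /✶ ρs ↑✶ k)
  der-/✶-↑✶ k ε        = refl
  der-/✶-↑✶ k (ρ ◅ ρs) = cong (λ t → TermApp._/_ l t _) (der-/✶-↑✶ k ρs)

  []-/✶-↑✶ : ∀ k {t u} (ρs : Subs T m n) →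
             (t [ u ]) /✶ ρs ↑✶ k ≡ (t /✶ ρs ↑✶ suc k) [ u /✶ ρs ↑✶ k ]
  []-/✶-↑✶ k ε        = refl
  []-/✶-↑✶ k (ρ ◅ ρs) = cong (λ t → TermApp._/_ l t _) ([]-/✶-↑✶ k ρs)

module _ {T₁ T₂ : ℕ → Set} {l₁ : Lift T₁ Term} {l₂ : Lift T₂ Term} where

  open TermSubst.Lifted termSubst l₁
    using () renaming (_↑✶_ to _↑✶₁_; _/✶_ to _/✶₁_)
  open TermSubst.Lifted termSubst l₂
    using () renaming (_↑✶_ to _↑✶₂_; _/✶_ to _/✶₂_)

  -- Quantifying over `k` lets the induction pass under binders, where `k` becomes `suc k`. The
  -- standard algebra of substitutions follows from this fact.
  /✶-↑✶ : (ρs₁ : Subs T₁ m n) (ρs₂ : Subs T₂ m n) →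
          (∀ k x → var x /✶₁ ρs₁ ↑✶₁ k ≡ var x /✶₂ ρs₂ ↑✶₂ k) →
          ∀ k t → t /✶₁ ρs₁ ↑✶₁ k ≡ t /✶₂ ρs₂ ↑✶₂ k
  /✶-↑✶ ρs₁ ρs₂ hyp k (var x) = hyp k x
  /✶-↑✶ ρs₁ ρs₂ hyp k (t · u) =
    trans (·-/✶-↑✶ l₁ k ρs₁)
      (trans (cong₂ _·_ (/✶-↑✶ ρs₁ ρs₂ hyp k t) (/✶-↑✶ ρs₁ ρs₂ hyp k u))
        (sym (·-/✶-↑✶ l₂ k ρs₂)))
  /✶-↑✶ ρs₁ ρs₂ hyp k (ƛ t) =
    trans (ƛ-/✶-↑✶ l₁ k ρs₁)
      (trans (cong ƛ (/✶-↑✶ ρs₁ ρs₂ hyp (suc k) t)) (sym (ƛ-/✶-↑✶ l₂ k ρs₂)))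
  /✶-↑✶ ρs₁ ρs₂ hyp k (! t) =
    trans (!-/✶-↑✶ l₁ k ρs₁)
      (trans (cong !_ (/✶-↑✶ ρs₁ ρs₂ hyp k t)) (sym (!-/✶-↑✶ l₂ k ρs₂)))
  /✶-↑✶ ρs₁ ρs₂ hyp k (der t) =
    trans (der-/✶-↑✶ l₁ k ρs₁)
      (trans (cong der (/✶-↑✶ ρs₁ ρs₂ hyp k t)) (sym (der-/✶-↑✶ l₂ k ρs₂)))
  /✶-↑✶ ρs₁ ρs₂ hyp k (t [ u ]) =
    trans ([]-/✶-↑✶ l₁ k ρs₁)
      (trans (cong₂ _[_] (/✶-↑✶ ρs₁ ρs₂ hyp (suc k) t) (/✶-↑✶ ρs₁ ρs₂ hyp k u))
        (sym ([]-/✶-↑✶ l₂ k ρs₂)))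

termLemmas : TermLemmas Term
termLemmas = record
  { termSubst = termSubst
  ; app-var   = refl
  ; /✶-↑✶     = /✶-↑✶
  }

open TermLemmas termLemmas
  using ( id; wk; _↑; _⊙_; id-vanishes; /-⊙; ↑⋆-distrib; ⊙-wk; wk-⊙-sub; wk-⊙-∷
        ; sub-commutes; id≡id; ↑≡↑; /Var≡/)

/Var-id : (t : Term n) → t /Var VarSubst.id ≡ t
/Var-id t = trans (/Var≡/ {ρ = VarSubst.id} {t = t}) (trans (cong (t /_) id≡id) (id-vanishes t))

-- Weakening before a substitution discards its first entry, so both sides are the tail of `ρ` with
-- `var` applied.
map-var-wk-⊙ : (ρ : Sub Fin (suc m) n) →
               map var (VarSubst.wk VarSubst.⊙ ρ) ≡ wk ⊙ map var ρ
map-var-wk-⊙ (x ∷ ρ) =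
  trans (cong (map var) (VarLemmas.extensionality λ y →
                           trans (VarLemmas.lookup-⊙ y {ρ₁ = VarSubst.wk} {ρ₂ = x ∷ ρ})
                                 (cong (lookup (x ∷ ρ)) (VarLemmas.lookup-wk y))))
        (sym (wk-⊙-∷ (var x) (map var ρ)))

-- Relates the two treatments of list contexts: `skip` weakens by one layer at a time, `wkᴸ` by all
-- layers at once.
/-wk-/Var : (t : Term m) (ρ : Sub Fin (suc m) n) →
            t / wk /Var ρ ≡ t /Var (VarSubst.wk VarSubst.⊙ ρ)
/-wk-/Var t ρ = begin
  t / wk /Var ρ       ≡⟨ /Var≡/ {ρ = ρ} {t = t / wk} ⟩
  t / wk / map var ρ  ≡⟨ /-⊙ t ⟨
  t / wk ⊙ map var ρ  ≡⟨ cong (t /_) (map-var-wk-⊙ ρ) ⟨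
  t / map var wkρ     ≡⟨ /Var≡/ {ρ = wkρ} {t = t} ⟨
  t /Var wkρ          ∎
  where
  open ≡-Reasoning
  wkρ = VarSubst.wk VarSubst.⊙ ρ

/-wk↑-/Var : (t : Term (suc m)) (ρ : Sub Fin (suc m) n) →
             t / wk ↑ /Var (ρ VarSubst.↑) ≡
             t /Var ((VarSubst.wk VarSubst.⊙ ρ) VarSubst.↑)
/-wk↑-/Var t ρ = begin
  t / wk ↑ /Var ρ VarSubst.↑         ≡⟨ /Var≡/ {ρ = ρ VarSubst.↑} {t = t / wk ↑} ⟩
  t / wk ↑ / map var (ρ VarSubst.↑)  ≡⟨ cong (t / wk ↑ /_) ↑≡↑ ⟩
  t / wk ↑ / map var ρ ↑             ≡⟨ /-⊙ t ⟨
  t / wk ↑ ⊙ map var ρ ↑             ≡⟨ cong (t /_) (↑⋆-distrib 1) ⟨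
  t / (wk ⊙ map var ρ) ↑             ≡⟨ cong (λ σ → t / σ ↑) (map-var-wk-⊙ ρ) ⟨
  t / map var wkρ ↑                  ≡⟨ cong (t /_) ↑≡↑ ⟨
  t / map var (wkρ VarSubst.↑)       ≡⟨ /Var≡/ {ρ = wkρ VarSubst.↑} {t = t} ⟨
  t /Var wkρ VarSubst.↑              ∎
  where
  open ≡-Reasoning
  wkρ = VarSubst.wk VarSubst.⊙ ρ

-- An inductive presentation of weak reduction

-- The three rules have the common shape F⟨L⟨a⟩⟩ ↦ L⟨r⟩, where F is one of the
-- frames □ u, t[x\□] and der □, and r is obtained from F and a alone.

data Frame (n : ℕ) : Set where
  arg  : (u : Term n) → Frame n
  body : (t : Term (suc n)) → Frame n
  der  : Frame n

infixl 8 _/ᶠ_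

_/ᶠ_ : Frame m → Sub Term m n → Frame n
arg u  /ᶠ σ = arg (u / σ)
body t /ᶠ σ = body (t / σ ↑)
der    /ᶠ σ = der

infix 4 _▷_↦_ _⟶_ _⟶ᶠ_

-- F ▷ r ↦ s stands for the root step F⟨r⟩ ↦ s; skip moves the frame under
-- one layer of the list context.
data _▷_↦_ {n : ℕ} : Frame n → Term n → Term n → Set where
  fire-dB : ∀ {t u} → arg u ▷ ƛ t ↦ t [ u ]
  fire-s! : ∀ {t u} → body t ▷ ! u ↦ t / sub u
  fire-d! : ∀ {t} → der ▷ ! t ↦ t
  skip    : ∀ {F r s v} → F /ᶠ wk ▷ r ↦ s → F ▷ r [ v ] ↦ s [ v ]

data _⟶_ {n : ℕ} : Rel (Term n) 0ℓ where
  step-dB : ∀ {r u s} → arg u ▷ r ↦ s → r · u ⟶ s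
  step-s! : ∀ {t r s} → body t ▷ r ↦ s → t [ r ] ⟶ s
  step-d! : ∀ {r s} → der ▷ r ↦ s → der r ⟶ s
  in-·ˡ   : ∀ {t t′ u} → t ⟶ t′ → t · u ⟶ t′ · u
  in-·ʳ   : ∀ {t u u′} → u ⟶ u′ → t · u ⟶ t · u′
  in-ƛ    : ∀ {t t′} → t ⟶ t′ → ƛ t ⟶ ƛ t′
  in-der  : ∀ {t t′} → t ⟶ t′ → der t ⟶ der t′
  in-[]ˡ  : ∀ {t t′ u} → t ⟶ t′ → t [ u ] ⟶ t′ [ u ]
  in-[]ʳ  : ∀ {t u u′} → u ⟶ u′ → t [ u ] ⟶ t [ u′ ]

data _⟶ᶠ_ {n : ℕ} : Rel (Frame n) 0ℓ where
  arg  : ∀ {u u′} → u ⟶ u′ → arg u ⟶ᶠ arg u′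
  body : ∀ {t t′} → t ⟶ t′ → body t ⟶ᶠ body t′

/ᶠ-id : (F : Frame n) → F /ᶠ id ≡ F
/ᶠ-id (arg u)  = cong arg (id-vanishes u)
/ᶠ-id (body t) = cong body (id-vanishes t)
/ᶠ-id der      = refl

/ᶠ-⊙ : ∀ {k} (F : Frame m) {σ : Sub Term m n} {τ : Sub Term n k} →
       F /ᶠ (σ ⊙ τ) ≡ F /ᶠ σ /ᶠ τ
/ᶠ-⊙ (arg u)          = cong arg (/-⊙ u)
/ᶠ-⊙ (body t) {σ} {τ} =
  cong body (trans (cong (t /_) (↑⋆-distrib {ρ₁ = σ} {ρ₂ = τ} 1)) (/-⊙ t))
/ᶠ-⊙ der              = refl

/ᶠ-wk-↑ : (F : Frame m) {σ : Sub Term m n} → F /ᶠ wk /ᶠ σ ↑ ≡ F /ᶠ σ /ᶠ wk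
/ᶠ-wk-↑ F = trans (sym (/ᶠ-⊙ F)) (trans (cong (F /ᶠ_) (sym ⊙-wk)) (/ᶠ-⊙ F))

/ᶠ-wk-sub : (F : Frame n) {u : Term n} → F /ᶠ wk /ᶠ sub u ≡ F
/ᶠ-wk-sub F =
  trans (sym (/ᶠ-⊙ F)) (trans (cong (F /ᶠ_) wk-⊙-sub) (/ᶠ-id F))

-- For `fire-s!` this is the substitution lemma. For `skip`, weakening the frame commutes with
-- lifting `σ`.
↦-/ : ∀ {F : Frame m} {r s} (σ : Sub Term m n) →
      F ▷ r ↦ s → F /ᶠ σ ▷ r / σ ↦ s / σ
↦-/ σ fire-dB          = fire-dB
↦-/ σ (fire-s! {t})    = subst (_ ▷ _ ↦_) (sym (sub-commutes t)) fire-s!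
↦-/ σ fire-d!          = fire-d!
↦-/ σ (skip {F} r↦s)   = skip (subst (_▷ _ ↦ _) (/ᶠ-wk-↑ F) (↦-/ (σ ↑) r↦s))

-- Since no step takes place under a bang, a variable replaced by any term leaves the redex in
-- place, and one step stays one step.
⟶-/ : ∀ {t u : Term m} (σ : Sub Term m n) → t ⟶ u → t / σ ⟶ u / σ
⟶-/ σ (step-dB r↦s) = step-dB (↦-/ σ r↦s)
⟶-/ σ (step-s! r↦s) = step-s! (↦-/ σ r↦s)
⟶-/ σ (step-d! r↦s) = step-d! (↦-/ σ r↦s)
⟶-/ σ (in-·ˡ t→u)   = in-·ˡ (⟶-/ σ t→u)
⟶-/ σ (in-·ʳ t→u)   = in-·ʳ (⟶-/ σ t→u)
⟶-/ σ (in-ƛ t→u)    = in-ƛ (⟶-/ (σ ↑) t→u)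
⟶-/ σ (in-der t→u)  = in-der (⟶-/ σ t→u)
⟶-/ σ (in-[]ˡ t→u)  = in-[]ˡ (⟶-/ (σ ↑) t→u)
⟶-/ σ (in-[]ʳ t→u)  = in-[]ʳ (⟶-/ σ t→u)

⟶ᶠ-/ : ∀ {F G : Frame m} (σ : Sub Term m n) → F ⟶ᶠ G → F /ᶠ σ ⟶ᶠ G /ᶠ σ
⟶ᶠ-/ σ (arg u→u′)  = arg (⟶-/ σ u→u′)
⟶ᶠ-/ σ (body t→t′) = body (⟶-/ (σ ↑) t→t′)

-- The diamond property

↦-deterministic : ∀ {F : Frame n} {r s s′} → F ▷ r ↦ s → F ▷ r ↦ s′ → s ≡ s′
↦-deterministic fire-dB    fire-dB     = refl
↦-deterministic fire-s!    fire-s!     = refl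
↦-deterministic fire-d!    fire-d!     = refl
↦-deterministic (skip r↦s) (skip r↦s′) = cong _[ _ ] (↦-deterministic r↦s r↦s′)

-- Firing neither copies nor erases the term held in the frame, so a step inside it survives as
-- exactly one step.
↦-⟶ᶠ : ∀ {F G : Frame n} {r s} → F ▷ r ↦ s → F ⟶ᶠ G →
       ∃ λ s′ → (G ▷ r ↦ s′) × (s ⟶ s′)
↦-⟶ᶠ fire-dB           (arg u→u′)  = _ , fire-dB , in-[]ʳ u→u′
↦-⟶ᶠ (fire-s! {u = u}) (body t→t′) = _ , fire-s! , ⟶-/ (sub u) t→t′
↦-⟶ᶠ (skip r↦s)        F→G         =
  let _ , r↦s′ , s→s′ = ↦-⟶ᶠ r↦s (⟶ᶠ-/ wk F→G) in _ , skip r↦s′ , in-[]ˡ s→s′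

-- The outermost layer of the list context crossed by the first step is itself
-- fired by the second.
↦-↦s! : ∀ {F : Frame n} {r s v w} → F /ᶠ wk ▷ r ↦ s → body r ▷ v ↦ w →
        ∃ λ s′ → (F ▷ w ↦ s′) × (body s ▷ v ↦ s′)
↦-↦s! {F = F} r↦s (fire-s! {u = u}) =
  -- Substituting `u` for the layer's variable cancels the weakening of `F`.
  _ , subst (_▷ _ ↦ _) (/ᶠ-wk-sub F) (↦-/ (sub u) r↦s) , fire-s!
↦-↦s! {F = F} r↦s (skip v↦w) =
  -- The body `r` moves under the layer of `v`, so the first step is renamed by `wk ↑`, which fixes
  -- the variable bound in `r`.
  let r↦s↑           = subst (_▷ _ ↦ _) (/ᶠ-wk-↑ F) (↦-/ (wk ↑) r↦s)
      _ , w↦s′ , v↦s′ = ↦-↦s! r↦s↑ v↦w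
  in  _ , skip w↦s′ , skip v↦s′

-- A bang has no reducts, so `fire-s!` and `fire-d!` give no case. Only a layer that is itself fired
-- changes the list context's shape at this level.
↦-⟶ : ∀ {F : Frame n} {r r′ s} → F ▷ r ↦ s → r ⟶ r′ →
      ∃ λ s′ → (F ▷ r′ ↦ s′) × (s ⟶ s′)
↦-⟶ fire-dB    (in-ƛ t→t′)   = _ , fire-dB , in-[]ˡ t→t′
↦-⟶ (skip r↦s) (step-s! v↦w) =
  let _ , w↦s′ , v↦s′ = ↦-↦s! r↦s v↦w in _ , w↦s′ , step-s! v↦s′
↦-⟶ (skip r↦s) (in-[]ˡ r→r′) =
  let _ , r′↦s′ , s→s′ = ↦-⟶ r↦s r→r′ in _ , skip r′↦s′ , in-[]ˡ s→s′
↦-⟶ (skip r↦s) (in-[]ʳ v→v′) = _ , skip r↦s , in-[]ʳ v→v′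

dB-peak : ∀ {r u s v : Term n} → arg u ▷ r ↦ s → r · u ⟶ v → Joinable _⟶_ s v
dB-peak r↦s (step-dB r↦v) = inj₁ (↦-deterministic r↦s r↦v)
dB-peak r↦s (in-·ˡ r→r′)  =
  let _ , r′↦s′ , s→s′ = ↦-⟶ r↦s r→r′ in inj₂ (_ , s→s′ , step-dB r′↦s′)
dB-peak r↦s (in-·ʳ u→u′)  =
  let _ , r↦s′ , s→s′ = ↦-⟶ᶠ r↦s (arg u→u′) in inj₂ (_ , s→s′ , step-dB r↦s′)

s!-peak : ∀ {t} {r s v : Term n} → body t ▷ r ↦ s → t [ r ] ⟶ v → Joinable _⟶_ s v
s!-peak r↦s (step-s! r↦v) = inj₁ (↦-deterministic r↦s r↦v)
s!-peak r↦s (in-[]ʳ r→r′) =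
  let _ , r′↦s′ , s→s′ = ↦-⟶ r↦s r→r′ in inj₂ (_ , s→s′ , step-s! r′↦s′)
s!-peak r↦s (in-[]ˡ t→t′) =
  let _ , r↦s′ , s→s′ = ↦-⟶ᶠ r↦s (body t→t′) in inj₂ (_ , s→s′ , step-s! r↦s′)

d!-peak : ∀ {r s v : Term n} → der ▷ r ↦ s → der r ⟶ v → Joinable _⟶_ s v
d!-peak r↦s (step-d! r↦v) = inj₁ (↦-deterministic r↦s r↦v)
d!-peak r↦s (in-der r→r′) =
  let _ , r′↦s′ , s→s′ = ↦-⟶ r↦s r→r′ in inj₂ (_ , s→s′ , step-d! r′↦s′)

⟶-joinable-sym : ∀ {t u : Term n} → Joinable _⟶_ t u → Joinable _⟶_ u t
⟶-joinable-sym (inj₁ t≡u)             = inj₁ (sym t≡u)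
⟶-joinable-sym (inj₂ (s , t→s , u→s)) = inj₂ (s , u→s , t→s)

⟶-joinable-cong : (f : Term m → Term n) → (∀ {t u} → t ⟶ u → f t ⟶ f u) →
                  ∀ {t u} → Joinable _⟶_ t u → Joinable _⟶_ (f t) (f u)
⟶-joinable-cong = joinable-map _⟶_ _⟶_

-- Peaks with a root step go to the three peak lemmas, up to symmetry. Steps in different immediate
-- subterms commute, and steps in the same one recurse.
⟶-diamond : Diamond (_⟶_ {n})
⟶-diamond (step-dB r↦s) q             = dB-peak r↦s q
⟶-diamond (step-s! r↦s) q             = s!-peak r↦s q
⟶-diamond (step-d! r↦s) q             = d!-peak r↦s q
⟶-diamond p@(in-·ˡ _)   (step-dB r↦s) = ⟶-joinable-sym (dB-peak r↦s p)
⟶-diamond p@(in-·ʳ _)   (step-dB r↦s) = ⟶-joinable-sym (dB-peak r↦s p)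
⟶-diamond p@(in-[]ˡ _)  (step-s! r↦s) = ⟶-joinable-sym (s!-peak r↦s p)
⟶-diamond p@(in-[]ʳ _)  (step-s! r↦s) = ⟶-joinable-sym (s!-peak r↦s p)
⟶-diamond p@(in-der _)  (step-d! r↦s) = ⟶-joinable-sym (d!-peak r↦s p)
⟶-diamond (in-·ˡ p)     (in-·ˡ q)     = ⟶-joinable-cong (_· _) in-·ˡ (⟶-diamond p q)
⟶-diamond (in-·ˡ p)     (in-·ʳ q)     = inj₂ (_ , in-·ʳ q , in-·ˡ p)
⟶-diamond (in-·ʳ p)     (in-·ˡ q)     = inj₂ (_ , in-·ˡ q , in-·ʳ p)
⟶-diamond (in-·ʳ p)     (in-·ʳ q)     = ⟶-joinable-cong (_ ·_) in-·ʳ (⟶-diamond p q)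
⟶-diamond (in-ƛ p)      (in-ƛ q)      = ⟶-joinable-cong ƛ in-ƛ (⟶-diamond p q)
⟶-diamond (in-der p)    (in-der q)    = ⟶-joinable-cong der in-der (⟶-diamond p q)
⟶-diamond (in-[]ˡ p)    (in-[]ˡ q)    = ⟶-joinable-cong _[ _ ] in-[]ˡ (⟶-diamond p q)
⟶-diamond (in-[]ˡ p)    (in-[]ʳ q)    = inj₂ (_ , in-[]ʳ q , in-[]ˡ p)
⟶-diamond (in-[]ʳ p)    (in-[]ˡ q)    = inj₂ (_ , in-[]ˡ q , in-[]ʳ p)
⟶-diamond (in-[]ʳ p)    (in-[]ʳ q)    = ⟶-joinable-cong (_ [_]) in-[]ʳ (⟶-diamond p q)

-- Equivalence of the two presentations

↦dB-complete : ∀ (L : LCtx n m) {t u} →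
               arg u ▷ L ⟨ ƛ t ⟩ᴸ ↦ L ⟨ t [ u /Var wkᴸ L ] ⟩ᴸ
↦dB-complete □ {t} {u} = subst (λ u′ → _ ▷ _ ↦ t [ u′ ]) (sym (/Var-id u)) fire-dB
↦dB-complete (L [ v ]) {t} {u} =
  skip (subst (λ u′ → _ ▷ _ ↦ L ⟨ t [ u′ ] ⟩ᴸ) (/-wk-/Var u (wkᴸ L)) (↦dB-complete L))

↦s!-complete : ∀ (L : LCtx n m) {t u} →
               body t ▷ L ⟨ ! u ⟩ᴸ ↦ L ⟨ (t /Var (wkᴸ L VarSubst.↑)) / sub u ⟩ᴸ
↦s!-complete □ {t} {u} = subst (λ t′ → _ ▷ _ ↦ t′ / sub u) (sym (/Var-id t)) fire-s!
↦s!-complete (L [ v ]) {t} {u} =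
  skip (subst (λ t′ → _ ▷ _ ↦ L ⟨ t′ / sub u ⟩ᴸ) (/-wk↑-/Var t (wkᴸ L)) (↦s!-complete L))

↦d!-complete : ∀ (L : LCtx n m) {t} → der ▷ L ⟨ ! t ⟩ᴸ ↦ L ⟨ t ⟩ᴸ
↦d!-complete □         = fire-d!
↦d!-complete (L [ v ]) = skip (↦d!-complete L)

↦dB-sound : ∀ {r u s : Term n} → arg u ▷ r ↦ s → r · u ↦dB s
↦dB-sound (fire-dB {t} {u}) =
  subst (λ u′ → ƛ t · u ↦dB t [ u′ ]) (/Var-id u) (dB □ t u)
-- Matching on the root step obtained for the weakened argument exposes `L`, which then receives the
-- outer layer `v`.
↦dB-sound (skip {arg u} {v = v} r↦s) with ↦dB-sound r↦s
... | dB L t _ =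
  subst (λ u′ → L ⟨ ƛ t ⟩ᴸ [ v ] · u ↦dB L ⟨ t [ u′ ] ⟩ᴸ [ v ])
        (sym (/-wk-/Var u (wkᴸ L))) (dB (L [ v ]) t u)

↦s!-sound : ∀ {t} {r s : Term n} → body t ▷ r ↦ s → t [ r ] ↦s! s
↦s!-sound (fire-s! {t} {u}) =
  subst (λ t′ → t [ ! u ] ↦s! t′ / sub u) (/Var-id t) (s! t □ u)
↦s!-sound (skip {body t} {v = v} r↦s) with ↦s!-sound r↦s
... | s! _ L u =
  subst (λ t′ → t [ L ⟨ ! u ⟩ᴸ [ v ] ] ↦s! L ⟨ t′ / sub u ⟩ᴸ [ v ])
        (sym (/-wk↑-/Var t (wkᴸ L))) (s! t (L [ v ]) u)

↦d!-sound : ∀ {r s : Term n} → der ▷ r ↦ s → der r ↦d! s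
↦d!-sound (fire-d! {t}) = d! □ t
↦d!-sound (skip {der} {v = v} r↦s) with ↦d!-sound r↦s
... | d! L t = d! (L [ v ]) t

⟶-weak : ∀ {s s′ : Term m} (W : WCtx n m) → s ⟶ s′ → W ⟨ s ⟩ᵂ ⟶ W ⟨ s′ ⟩ᵂ
⟶-weak □          s→s′ = s→s′
⟶-weak (W ·ˡ t)   s→s′ = in-·ˡ (⟶-weak W s→s′)
⟶-weak (t ·ʳ W)   s→s′ = in-·ʳ (⟶-weak W s→s′)
⟶-weak (ƛ W)      s→s′ = in-ƛ (⟶-weak W s→s′)
⟶-weak (der W)    s→s′ = in-der (⟶-weak W s→s′)
⟶-weak (W [ u ]ˡ) s→s′ = in-[]ˡ (⟶-weak W s→s′)
⟶-weak (t [ W ]ʳ) s→s′ = in-[]ʳ (⟶-weak W s→s′)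

→w⇒⟶ : ∀ {t u : Term n} → t →w u → t ⟶ u
→w⇒⟶ (inj₁ (weak W (dB L t u)))        = ⟶-weak W (step-dB (↦dB-complete L))
→w⇒⟶ (inj₂ (inj₁ (weak W (s! t L u)))) = ⟶-weak W (step-s! (↦s!-complete L))
→w⇒⟶ (inj₂ (inj₂ (weak W (d! L t))))   = ⟶-weak W (step-d! (↦d!-complete L))

-- `f` is polymorphic in `R`, so one context extension serves all three rules.
→w-map : {t t′ : Term m} {u u′ : Term n} →
         (∀ {R : ∀ {k} → Rel (Term k) 0ℓ} → WeakClosure R t t′ → WeakClosure R u u′) →
         t →w t′ → u →w u′
→w-map f = Sum.map f (Sum.map f f)

⟶⇒→w : ∀ {t u : Term n} → t ⟶ u → t →w u
⟶⇒→w (step-dB r↦s) = inj₁ (weak □ (↦dB-sound r↦s))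
⟶⇒→w (step-s! r↦s) = inj₂ (inj₁ (weak □ (↦s!-sound r↦s)))
⟶⇒→w (step-d! r↦s) = inj₂ (inj₂ (weak □ (↦d!-sound r↦s)))
⟶⇒→w (in-·ˡ p)     = →w-map (λ { (weak W r) → weak (W ·ˡ _) r }) (⟶⇒→w p)
⟶⇒→w (in-·ʳ p)     = →w-map (λ { (weak W r) → weak (_ ·ʳ W) r }) (⟶⇒→w p)
⟶⇒→w (in-ƛ p)      = →w-map (λ { (weak W r) → weak (ƛ W) r }) (⟶⇒→w p)
⟶⇒→w (in-der p)    = →w-map (λ { (weak W r) → weak (der W) r }) (⟶⇒→w p)
⟶⇒→w (in-[]ˡ p)    = →w-map (λ { (weak W r) → weak (W [ _ ]ˡ) r }) (⟶⇒→w p)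
⟶⇒→w (in-[]ʳ p)    = →w-map (λ { (weak W r) → weak (_ [ W ]ʳ) r }) (⟶⇒→w p)

→w-diamond : Diamond (_→w_ {n})
→w-diamond p q = joinable-map _⟶_ _→w_ (λ t → t) ⟶⇒→w (⟶-diamond (→w⇒⟶ p) (→w⇒⟶ q))

theorem2p8 : (n : ℕ) →
    Confluent (_→w_ {n}) ×
    (∀ {t u v : Term n} → IsNormalForm _→w_ u → IsNormalForm _→w_ v →
    (p : Star _→w_ t u) (q : Star _→w_ t v) → length p ≡ length q)
theorem2p8 n =
  diamond⇒confluent →w-diamond , normalising-paths-equally-long →w-diamond
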